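{- Let $k\ge 3$ be fixed and $n\ge k^2/(k-1)$. Suppose that $\mathcal{F}\subset\binom{[n]}{k}$ is a $(k,2k)$-conditionally intersecting family. Then $|\mathcal{F}|\le\binom{n-1}{k-1}$.
   Context: $[n]=\{1,\ldots,n\}$, and $\binom{[n]}{k}$ denotes the collection of all $k$-element subsets of $[n]$. A family $\mathcal{F}\subset\binom{[n]}{k}$ is called $(d,s)$-conditionally intersecting if there do not exist $d$ distinct sets $A_1,\ldots,A_d\in\mathcal{F}$ with $|A_1\cup\cdots\cup A_d|\le s$ and $A_1\cap\cdots\cap A_d=\emptyset$; here $d=k$ and $s=2k$. -}

module Defs where

open import Data.Nat using (ℕ; _≤_)
open import Data.Fin.Subset using (Subset; ∣_∣; ⋃; ⋂; Empty)
open import Data.List using (List; length)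
open import Data.List.Relation.Unary.All using (All)
open import Data.List.Relation.Unary.Unique.Propositional using (Unique)
open import Data.List.Relation.Binary.Subset.Propositional using (_⊆_)
open import Data.Product using (_×_; ∃-syntax)
open import Relation.Binary.PropositionalEquality using (_≡_)
open import Relation.Nullary using (¬_)

-- The ground set [n] is Fin n.  A family of subsets is a duplicate-free list,
-- so that its cardinality is the length of the list.
record Family (n k : ℕ) : Set where
  field
    members  : List (Subset n)
    distinct : Unique members
    uniform  : All (λ A → ∣ A ∣ ≡ k) members

open Family public

size : ∀ {n k} → Family n k → ℕ
size F = length (members F)

-- The d distinct sets A₁, …, A_d are the entries of a duplicate-free list of
-- length d.
ConditionallyIntersecting : ∀ {n k} → (d s : ℕ) → Family n k → Set
ConditionallyIntersecting d s F =
  ¬ (∃[ As ] (length As ≡ d × Unique As × As ⊆ members F ×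
              ∣ ⋃ As ∣ ≤ s × Empty (⋂ As)))

{-# OPTIONS --safe #-}

-- Split F into F₂, the members A all of whose facets A - x lie in some other
-- member, and the rest F₁.  For A ∈ F₂ choose for each x ∈ A another member
-- B_x = A - x + y_x ⊇ A - x.  These k distinct sets have a union of size at most
-- 2k, and an empty intersection unless all y_x coincide; hence y_x = y does not
-- depend on x or on the choices.  It follows that every B_x is again in F₂, that
-- a facet of A lies in exactly two members, both in F₂, and that therefore
-- k |F₂| ≤ 2 |∂F₂| for the set ∂F₂ of facets of members of F₂.
--
-- Let A′ be a facet of A ∈ F₁ that lies in no other member.  The pairs
-- (A′ , complement of A) for A ∈ F₁ and (S , complement of S) for S ∈ ∂F₂ are
-- cross-intersecting, so Bollobás's inequality, with the two kinds of pairs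
-- weighted according to their sizes, gives
--   n |F₁| + (n - k + 1) |∂F₂| ≤ n ((n - 1) C (k - 1)).
-- The two inequalities bound |F₁| + |F₂|.

module Submission where

open import Defs
open import Data.Nat using (ℕ; _≤_; _≥_; _*_; _∸_)
open import Data.Nat.Combinatorics using (_C_)

open import Data.Nat using (zero; suc; _+_; z≤n; s≤s; _!)
open import Data.Nat.Properties
import Data.Nat.ListAction as ListAction
open import Data.Nat.ListAction.Properties using (sum-++)
open import Data.Nat.Combinatorics using (nCk≡n!/k![n-k]!; k![n∸k]!∣n!)
open import Data.Nat.DivMod using (m/n*n≡m)
open import Data.Nat.Tactic.RingSolver using (solve-∀)
open import Algebra.Properties.CommutativeMonoid.Sum +-0-commutativeMonoid
  using (sum; sum-remove; sum-cong-≗; ∑-distrib-+)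
open import Algebra.Properties.Semiring.Sum +-*-semiring using (*-distribʳ-sum)
open import Algebra.Properties.CommutativeSemigroup +-commutativeSemigroup using (x∙yz≈y∙xz)
open import Data.Bool using (if_then_else_; true; false)
import Data.Bool.Properties as Bool
open import Data.Fin using (Fin; zero; suc; punchOut)
import Data.Fin.Properties as Fin
open import Data.Fin.Subset
  using (Subset; Side; inside; outside; _∈_; _∉_; _⊆_; _⊈_; _∪_; _-_; ∣_∣; ⋃; ⋂; ⁅_⁆; ⊥; Empty;
         Nonempty)
open import Data.Fin.Subset.Properties
  using (_∈?_; _⊆?_; drop-∷-⊆; ⊆-antisym; p⊆q⇒∣p∣≤∣q∣; p⊂q⇒∣p∣<∣q∣; p─q⊆p; p─⊥≡p;
         x∈p∧x≢y⇒x∈p-y; x∈p∪q⁻; x∈p∪q⁺; x∈p∩q⁻; x∈⁅x⁆; nonempty?; Empty-unique; ∣⊥∣≡0; ∣⁅x⁆∣≡1)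
open import Data.Vec using ([]; _∷_; here; there; lookup)
open import Data.Vec.Functional using (removeAt)
open import Data.Vec.Properties using (≡-dec; lookup⇒[]=; []=⇒lookup)
open import Data.List
  using (List; []; _∷_; map; length; filter; concatMap; deduplicate; _++_)
open import Data.List.Properties using (length-map; length-++; map-++; map-∘)
open import Data.List.Membership.Propositional using (find; lose) renaming (_∈_ to _∈ₗ_)
open import Data.List.Membership.Propositional.Properties
  using (∈-map⁺; ∈-map⁻; ∈-filter⁺; ∈-filter⁻; ∈-concatMap⁺; ∈-concatMap⁻; ∈-deduplicate⁺;
         ∈-deduplicate⁻; ∈-∃++)
import Data.List.Relation.Binary.Subset.Propositional as List
open import Data.List.Relation.Unary.Any as Any using (Any; here; there)
open import Data.List.Relation.Unary.All as All using (All; []; _∷_)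
import Data.List.Relation.Unary.All.Properties as All
open import Data.List.Relation.Unary.AllPairs using (AllPairs; []; _∷_)
import Data.List.Relation.Unary.AllPairs.Properties as AllPairs
open import Data.List.Relation.Unary.Unique.Propositional using (Unique)
import Data.List.Relation.Unary.Unique.Propositional.Properties as Unique
open import Data.List.Relation.Unary.Unique.DecPropositional.Properties using (deduplicate-!)
open import Data.Product using (_×_; _,_; proj₁; proj₂; ∃-syntax)
open import Data.Sum using (inj₁; inj₂)
open import Function using (_∘_; case_of_)
open import Relation.Nullary using (Dec; yes; no; ¬_; does; contradiction)
open import Relation.Nullary.Decidable
  using (_×-dec_; _→-dec_; ¬?; decidable-stable; dec-true; dec-false)
open import Relation.Unary using (Decidable)
import Relation.Binary as B
open import Relation.Binary.PropositionalEquality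
  using (_≡_; _≢_; refl; sym; trans; cong; cong₂; subst; module ≡-Reasoning)

private variable
  n : ℕ
  X Y : Set

-- Bollobás's inequality for colourings

data Colour : Set where
  before free after : Colour

before? : Decidable (_≡ before)
before? before = yes refl
before? free   = no λ ()
before? after  = no λ ()

after? : Decidable (_≡ after)
after? before = no λ ()
after? free   = no λ ()
after? after  = yes refl

isBefore isFree isAfter : Colour → ℕ
isBefore before = 1
isBefore _      = 0
isFree free = 1
isFree _    = 0
isAfter after = 1
isAfter _     = 0

Colouring : ℕ → Set
Colouring n = Fin n → Colour

#before #free #after : ∀ {n} → Colouring n → ℕ
#before v = sum (isBefore ∘ v)
#free   v = sum (isFree ∘ v)
#after  v = sum (isAfter ∘ v)

HasAfter : ∀ {n} → Colouring n → Set
HasAfter v = ∃[ i ] v i ≡ after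

hasAfter? : ∀ {n} → Decidable (HasAfter {n})
hasAfter? v = Fin.any? (λ i → after? (v i))

-- The number of linear orders of Fin n in which every point coloured before
-- precedes every point coloured after.  The recursion is on the last point of
-- the order; if no point is coloured after, every order qualifies.
mutual
  orders : ∀ {n} → Colouring n → ℕ
  orders {zero}  v = 1
  orders {suc n} v = if does (hasAfter? v) then sum (ordersEndingAt v) else suc n !

  ordersEndingAt : ∀ {n} → Colouring (suc n) → Fin (suc n) → ℕ
  ordersEndingAt v x = if does (before? (v x)) then 0 else orders (removeAt v x)

orders-hasAfter : ∀ {n} {v : Colouring (suc n)} → HasAfter v → orders v ≡ sum (ordersEndingAt v)
orders-hasAfter {n} {v} h =
  cong (λ b → if b then sum (ordersEndingAt v) else suc n !) (dec-true (hasAfter? v) h)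

orders-¬hasAfter : ∀ {n} {v : Colouring (suc n)} → ¬ HasAfter v → orders v ≡ suc n !
orders-¬hasAfter {n} {v} ¬h =
  cong (λ b → if b then sum (ordersEndingAt v) else suc n !) (dec-false (hasAfter? v) ¬h)

sum-const : ∀ n c → sum {n} (λ _ → c) ≡ n * c
sum-const zero    c = refl
sum-const (suc n) c = cong (c +_) (sum-const n c)

sum-mono-≤ : ∀ {n} {f g : Fin n → ℕ} → (∀ i → f i ≤ g i) → sum f ≤ sum g
sum-mono-≤ {zero}  f≤g = z≤n
sum-mono-≤ {suc n} f≤g = +-mono-≤ (f≤g zero) (sum-mono-≤ (f≤g ∘ suc))

#after-¬hasAfter : ∀ {n} (v : Colouring n) → ¬ HasAfter v → #after v ≡ 0
#after-¬hasAfter {zero}  v ¬h = refl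
#after-¬hasAfter {suc n} v ¬h with v zero in eq
... | before = #after-¬hasAfter (v ∘ suc) λ (i , e) → ¬h (suc i , e)
... | free   = #after-¬hasAfter (v ∘ suc) λ (i , e) → ¬h (suc i , e)
... | after  = contradiction (zero , eq) ¬h

#-total : ∀ {n} (v : Colouring n) → #before v + #after v + #free v ≡ n
#-total {zero}  v = refl
#-total {suc n} v = trans (lemma (v zero) (#before w) (#after w) (#free w)) (cong suc (#-total w))
  where
  w : Colouring n
  w = v ∘ suc
  lemma : ∀ c l r f → (isBefore c + l) + (isAfter c + r) + (isFree c + f) ≡ suc (l + r + f)
  lemma before = solve-∀
  lemma free   = solve-∀
  lemma after  = solve-∀

#after-pos : ∀ {n} {v : Colouring n} → HasAfter v → ∃[ r ] #after v ≡ suc r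
#after-pos {suc n} {v} (i , e) =
  #after (removeAt v i) ,
  trans (sum-remove {i = i} (isAfter ∘ v)) (cong (λ c → isAfter c + #after (removeAt v i)) e)

-- This is the count `n! l! r! / (l + r)!`, cleared of its denominator, where `l` points are
-- `before` and `r` are `after`. If some point is `after`, the last point of the order is `after` or
-- `free`, and the contributions add up because `before`, `after` and `free` points together exhaust
-- the ground set.
orders-formula : ∀ {n} (v : Colouring n) →
  orders v * (#before v + #after v) ! ≡ n ! * (#before v ! * #after v !)
orders-formula {zero}  v = refl
orders-formula {suc n} v with hasAfter? v
... | no ¬h rewrite orders-¬hasAfter ¬h | #after-¬hasAfter v ¬h | +-identityʳ (#before v) =
  cong (suc n ! *_) (sym (*-identityʳ (#before v !)))
... | yes h with r , R≡ ← #after-pos h = begin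
  orders v * (l + #after v) !
    ≡⟨ cong (_* (l + #after v) !) (orders-hasAfter h) ⟩
  sum (ordersEndingAt v) * (l + #after v) !
    ≡⟨ *-distribʳ-sum ((l + #after v) !) (ordersEndingAt v) ⟩
  sum (λ x → ordersEndingAt v x * (l + #after v) !)
    ≡⟨ sum-cong-≗ summand ⟩
  sum (λ x → isAfter (v x) * a + isFree (v x) * b)
    ≡⟨ ∑-distrib-+ (λ x → isAfter (v x) * a) (λ x → isFree (v x) * b) ⟩
  sum (λ x → isAfter (v x) * a) + sum (λ x → isFree (v x) * b)
    ≡⟨ cong₂ _+_ (*-distribʳ-sum a (isAfter ∘ v)) (*-distribʳ-sum b (isFree ∘ v)) ⟨
  #after v * a + #free v * b
    ≡⟨ cong (λ m → m * a + #free v * b) R≡ ⟩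
  suc r * a + #free v * b
    ≡⟨ collect r (l + suc r) (#free v) (n !) (l !) (r !) ⟩
  (l + suc r + #free v) * n ! * (l ! * suc r !)
    ≡⟨ cong (λ m → (l + m + #free v) * n ! * (l ! * m !)) R≡ ⟨
  (l + #after v + #free v) * n ! * (l ! * #after v !)
    ≡⟨ cong (λ m → m * n ! * (l ! * #after v !)) (#-total v) ⟩
  suc n ! * (l ! * #after v !) ∎
  where
  open ≡-Reasoning
  -- After multiplication by `(l + #after v) !`, every last point coloured `after` contributes `a`
  -- and every `free` one contributes `b`.
  l a b : ℕ
  l = #before v
  a = (l + suc r) * (n ! * (l ! * r !))
  b = n ! * (l ! * suc r !)

  collect : ∀ r t f x y z →
    suc r * (t * (x * (y * z))) + f * (x * (y * (suc r * z))) ≡ (t + f) * x * (y * (suc r * z))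
  collect = solve-∀

  pull : ∀ o t u → o * (t * u) ≡ t * (o * u)
  pull = solve-∀

  summand : ∀ x → ordersEndingAt v x * (l + #after v) ! ≡ isAfter (v x) * a + isFree (v x) * b
  summand x with v x | sum-remove {i = x} (isBefore ∘ v) | sum-remove {i = x} (isAfter ∘ v)
                     | orders-formula (removeAt v x)
  ... | before | _  | _  | _  = refl
  ... | free   | eL | eR | ih rewrite sym eL | sym eR | R≡ =
    trans ih (sym (+-identityʳ b))
  ... | after  | eL | eR | ih with refl ← suc-injective (trans (sym R≡) eR) = begin
    o * (l + #after v) !          ≡⟨ cong (λ m → o * m !) (trans (cong (l +_) R≡) (+-suc l r)) ⟩
    o * (suc (l + r) * (l + r) !) ≡⟨ pull o (suc (l + r)) ((l + r) !) ⟩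
    suc (l + r) * (o * (l + r) !) ≡⟨ cong (λ m → suc (l + r) * (o * (m + r) !)) eL ⟩
    suc (l + r) * (o * (#before (removeAt v x) + r) !) ≡⟨ cong (suc (l + r) *_) ih ⟩
    suc (l + r) * (n ! * (#before (removeAt v x) ! * r !))
      ≡⟨ cong₂ (λ m p → m * (n ! * (p ! * r !))) (+-suc l r) eL ⟨
    a                              ≡⟨ trans (+-identityʳ (a + 0)) (+-identityʳ a) ⟨
    a + 0 + 0 ∎
    where
    o : ℕ
    o = orders (removeAt v x)

-- If `i` and `j` are the two witnesses, an order respecting `v` puts `i` before `j`, while one
-- respecting `w` puts `j` before `i`.
Cross : ∀ {n} → Colouring n → Colouring n → Set
Cross v w = (∃[ i ] (v i ≡ before × w i ≡ after)) × (∃[ i ] (w i ≡ before × v i ≡ after))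

-- These are the conditions left on the other points once `x` is placed last. A colouring with `x`
-- coloured `before` is dropped, in line with the value 0 in `ordersEndingAt`.
restrict : ∀ {n} → Fin (suc n) → List (Colouring (suc n)) → List (Colouring n)
restrict x []       = []
restrict x (v ∷ vs) with does (before? (v x))
... | true  = restrict x vs
... | false = removeAt v x ∷ restrict x vs

-- The witness is coloured `before` by `v`, so it differs from `x` and survives the removal.
removeAt-witness : ∀ {n} {x : Fin (suc n)} {v w : Colouring (suc n)} → v x ≢ before →
  ∃[ i ] (v i ≡ before × w i ≡ after) →
  ∃[ j ] (removeAt v x j ≡ before × removeAt w x j ≡ after)
removeAt-witness {x = x} {v} {w} vx≢ (i , vi , wi) =
  punchOut x≢i ,
  trans (cong v (Fin.punchIn-punchOut x≢i)) vi ,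
  trans (cong w (Fin.punchIn-punchOut x≢i)) wi
  where
  x≢i : x ≢ i
  x≢i refl = vx≢ vi

restrict-All : ∀ {n} x {v : Colouring (suc n)} → v x ≢ before → ∀ {vs} →
  All (Cross v) vs → All (Cross (removeAt v x)) (restrict x vs)
restrict-All x vx≢ [] = []
restrict-All x vx≢ {w ∷ _} ((p , q) ∷ cs) with before? (w x)
... | yes _  = restrict-All x vx≢ cs
... | no wx≢ = (removeAt-witness vx≢ p , removeAt-witness wx≢ q) ∷ restrict-All x vx≢ cs

restrict-AllPairs : ∀ {n} x {vs : List (Colouring (suc n))} →
  AllPairs Cross vs → AllPairs Cross (restrict x vs)
restrict-AllPairs x [] = []
restrict-AllPairs x {v ∷ _} (c ∷ cs) with before? (v x)
... | yes _  = restrict-AllPairs x cs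
... | no vx≢ = restrict-All x vx≢ c ∷ restrict-AllPairs x cs

total : ∀ {n} → List (Colouring n) → ℕ
total vs = ListAction.sum (map orders vs)

-- The sums over colourings and over last points are interchanged; `HasAfter` makes each `orders`
-- unfold to a sum over last points.
total-restrict : ∀ {n} {vs : List (Colouring (suc n))} → All HasAfter vs →
  total vs ≡ sum (λ x → total (restrict x vs))
total-restrict {n} [] = sym (trans (sum-const (suc n) 0) (zeroʳ n))
  where
  zeroʳ : ∀ m → m * 0 ≡ 0
  zeroʳ = solve-∀
total-restrict {vs = v ∷ vs} (h ∷ hs) = begin
  orders v + total vs
    ≡⟨ cong₂ _+_ (orders-hasAfter h) (total-restrict hs) ⟩
  sum (ordersEndingAt v) + sum (λ x → total (restrict x vs))
    ≡⟨ ∑-distrib-+ (ordersEndingAt v) (λ x → total (restrict x vs)) ⟨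
  sum (λ x → ordersEndingAt v x + total (restrict x vs))
    ≡⟨ sum-cong-≗ split ⟩
  sum (λ x → total (restrict x (v ∷ vs))) ∎
  where
  open ≡-Reasoning
  split : ∀ x → ordersEndingAt v x + total (restrict x vs) ≡ total (restrict x (v ∷ vs))
  split x with does (before? (v x))
  ... | true  = refl
  ... | false = refl

-- The events "before precedes after" of cross-intersecting colourings are
-- pairwise incompatible, so a linear order satisfies at most one of them.
total≤n! : ∀ {n} (vs : List (Colouring n)) → AllPairs Cross vs → total vs ≤ n !
total≤n! {zero} []          _ = z≤n
total≤n! {zero} (_ ∷ [])    _ = ≤-refl
-- An empty ground set has no point to witness `Cross`.
total≤n! {zero} (_ ∷ _ ∷ _) ((((() , _) , _) ∷ _) ∷ _)
total≤n! {suc n} vs cs = by-size vs cs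
  where
  step : ∀ {vs} → All HasAfter vs → AllPairs Cross vs → total vs ≤ suc n !
  step {vs} hs cs = begin
    total vs
      ≡⟨ total-restrict hs ⟩
    sum (λ x → total (restrict x vs))
      ≤⟨ sum-mono-≤ (λ x → total≤n! (restrict x vs) (restrict-AllPairs x cs)) ⟩
    sum {suc n} (λ _ → n !)
      ≡⟨ sum-const (suc n) (n !) ⟩
    suc n ! ∎
    where open ≤-Reasoning

  by-size : ∀ vs → AllPairs Cross vs → total vs ≤ suc n !
  by-size [] _ = z≤n
  by-size (v ∷ []) cs with hasAfter? v
  ... | yes h = step (h ∷ []) cs
  ... | no ¬h = ≤-reflexive (trans (+-identityʳ (orders v)) (orders-¬hasAfter ¬h))
  -- Among two or more colourings, crossing supplies each with a point coloured `after`, so the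
  -- recursion on the last point applies; only a lone colouring can lack one.
  by-size (v ∷ w ∷ vs) cs@((c@(_ , j , _ , e) ∷ cs′) ∷ _) =
    step ((j , e) ∷ All.map (λ ((i , _ , e′) , _) → i , e′) (c ∷ cs′)) cs

-- Lists

allPairs-map⁺ : {R : Y → Y → Set} {f : X → Y} {xs : List X} →
  (∀ {x y} → x ∈ₗ xs → y ∈ₗ xs → x ≢ y → R (f x) (f y)) → Unique xs → AllPairs R (map f xs)
allPairs-map⁺ r []         = []
allPairs-map⁺ r (x∉ ∷ xs!) =
  All.map⁺ (All.tabulate λ y∈ → r (here refl) (there y∈) (All.lookup x∉ y∈)) ∷
  allPairs-map⁺ (λ x∈ y∈ → r (there x∈) (there y∈)) xs!

∈-remove : ∀ {x z : X} us {vs} → z ∈ₗ us ++ x ∷ vs → z ≢ x → z ∈ₗ us ++ vs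
∈-remove []       (here z≡x) z≢x = contradiction z≡x z≢x
∈-remove []       (there z∈) z≢x = z∈
∈-remove (u ∷ us) (here z≡u) z≢x = here z≡u
∈-remove (u ∷ us) (there z∈) z≢x = there (∈-remove us z∈ z≢x)

unique-⊆⇒length≤ : {xs ys : List X} → Unique xs → xs List.⊆ ys → length xs ≤ length ys
unique-⊆⇒length≤ []         _   = z≤n
unique-⊆⇒length≤ {xs = x ∷ xs} (x∉ ∷ xs!) sub with us , vs , refl ← ∈-∃++ (sub (here refl)) = begin
  suc (length xs)           ≤⟨ s≤s (unique-⊆⇒length≤ xs! λ z∈ →
                                 ∈-remove us (sub (there z∈)) (All.lookup x∉ z∈ ∘ sym)) ⟩
  suc (length (us ++ vs))   ≡⟨ cong suc (length-++ us) ⟩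
  suc (length us + length vs) ≡⟨ +-suc (length us) (length vs) ⟨
  length us + suc (length vs) ≡⟨ length-++ us ⟨
  length (us ++ x ∷ vs) ∎
  where open ≤-Reasoning

sum-map-const : (f : X → ℕ) (c : ℕ) (xs : List X) → (∀ {x} → x ∈ₗ xs → f x ≡ c) →
  ListAction.sum (map f xs) ≡ length xs * c
sum-map-const f c []       _  = refl
sum-map-const f c (x ∷ xs) eq = cong₂ _+_ (eq (here refl)) (sum-map-const f c xs (eq ∘ there))

sum-map-mono : (f g : X → ℕ) (xs : List X) → (∀ {x} → x ∈ₗ xs → f x ≤ g x) →
  ListAction.sum (map f xs) ≤ ListAction.sum (map g xs)
sum-map-mono f g []       _  = z≤n
sum-map-mono f g (x ∷ xs) le = +-mono-≤ (le (here refl)) (sum-map-mono f g xs (le ∘ there))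

length-filter-¬ : {P : X → Set} (P? : Decidable P) (xs : List X) →
  length (filter (¬? ∘ P?) xs) + length (filter P? xs) ≡ length xs
length-filter-¬ P? [] = refl
length-filter-¬ P? (x ∷ xs) with does (P? x)
... | true  = trans (+-suc _ _) (cong suc (length-filter-¬ P? xs))
... | false = cong suc (length-filter-¬ P? xs)

-- Double counting along a relation.

module _ {R : X → Y → Set} (R? : B.Decidable R) where

  outDegree : List Y → X → ℕ
  outDegree ys x = length (filter (R? x) ys)

  inDegree : List X → Y → ℕ
  inDegree xs y = length (filter (λ x → R? x y) xs)

  ∑inDegree : List X → List Y → ℕ
  ∑inDegree xs ys = ListAction.sum (map (inDegree xs) ys)

  ∑inDegree-∷ : ∀ x xs ys → ∑inDegree (x ∷ xs) ys ≡ outDegree ys x + ∑inDegree xs ys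
  ∑inDegree-∷ x xs [] = refl
  ∑inDegree-∷ x xs (y ∷ ys) rewrite ∑inDegree-∷ x xs ys with does (R? x y)
  ... | true  = cong suc (x∙yz≈y∙xz (inDegree xs y) (outDegree ys x) (∑inDegree xs ys))
  ... | false = x∙yz≈y∙xz (inDegree xs y) (outDegree ys x) (∑inDegree xs ys)

  double-counting : ∀ xs ys → ListAction.sum (map (outDegree ys) xs) ≡ ∑inDegree xs ys
  double-counting []       ys =
    sym (trans (sum-map-const (λ _ → 0) 0 ys (λ _ → refl)) (*-zeroʳ (length ys)))
  double-counting (x ∷ xs) ys =
    trans (cong (outDegree ys x +_) (double-counting xs ys)) (sym (∑inDegree-∷ x xs ys))

-- Finite subsets

_≟ₛ_ : B.DecidableEquality (Subset n)
_≟ₛ_ = ≡-dec Bool._≟_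

elements : Subset n → List (Fin n)
elements []            = []
elements (inside  ∷ p) = zero ∷ map suc (elements p)
elements (outside ∷ p) = map suc (elements p)

length-elements : (p : Subset n) → length (elements p) ≡ ∣ p ∣
length-elements []            = refl
length-elements (inside  ∷ p) = cong suc (trans (length-map suc (elements p)) (length-elements p))
length-elements (outside ∷ p) = trans (length-map suc (elements p)) (length-elements p)

∈-elements⁺ : {p : Subset n} {x : Fin n} → x ∈ p → x ∈ₗ elements p
∈-elements⁺                    here       = here refl
∈-elements⁺ {p = inside  ∷ _} (there x∈) = there (∈-map⁺ suc (∈-elements⁺ x∈))
∈-elements⁺ {p = outside ∷ _} (there x∈) = ∈-map⁺ suc (∈-elements⁺ x∈)

∈-elements⁻ : (p : Subset n) {x : Fin n} → x ∈ₗ elements p → x ∈ p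
∈-elements⁻ (inside  ∷ p) (here refl) = here
∈-elements⁻ (inside  ∷ p) (there x∈) with y , y∈ , refl ← ∈-map⁻ suc x∈ = there (∈-elements⁻ p y∈)
∈-elements⁻ (outside ∷ p) x∈         with y , y∈ , refl ← ∈-map⁻ suc x∈ = there (∈-elements⁻ p y∈)

elements-unique : (p : Subset n) → Unique (elements p)
elements-unique []            = []
elements-unique (inside  ∷ p) =
  All.map⁺ (All.tabulate λ _ ()) ∷ Unique.map⁺ Fin.suc-injective (elements-unique p)
elements-unique (outside ∷ p) = Unique.map⁺ Fin.suc-injective (elements-unique p)

x∉p-x : (p : Subset n) (x : Fin n) → x ∉ p - x
x∉p-x (_ ∷ p) (suc x) (there x∈) = x∉p-x p x x∈

x∈p-y⇒x≢y : {p : Subset n} {x y : Fin n} → x ∈ p - y → x ≢ y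
x∈p-y⇒x≢y {p = p} {x} x∈ refl = x∉p-x p x x∈

p-x⊆p : (p : Subset n) (x : Fin n) → p - x ⊆ p
p-x⊆p p x = p─q⊆p p ⁅ x ⁆

suc∣p-x∣≡∣p∣ : {p : Subset n} {x : Fin n} → x ∈ p → suc ∣ p - x ∣ ≡ ∣ p ∣
suc∣p-x∣≡∣p∣ {p = inside  ∷ p} here       = cong (suc ∘ ∣_∣) (p─⊥≡p p)
suc∣p-x∣≡∣p∣ {p = inside  ∷ p} (there x∈) = cong suc (suc∣p-x∣≡∣p∣ x∈)
suc∣p-x∣≡∣p∣ {p = outside ∷ p} (there x∈) = suc∣p-x∣≡∣p∣ x∈

∣p∪q∣≤∣p∣+∣q∣ : (p q : Subset n) → ∣ p ∪ q ∣ ≤ ∣ p ∣ + ∣ q ∣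
∣p∪q∣≤∣p∣+∣q∣ []            []            = z≤n
∣p∪q∣≤∣p∣+∣q∣ (outside ∷ p) (outside ∷ q) = ∣p∪q∣≤∣p∣+∣q∣ p q
∣p∪q∣≤∣p∣+∣q∣ (outside ∷ p) (inside  ∷ q) =
  ≤-trans (s≤s (∣p∪q∣≤∣p∣+∣q∣ p q)) (≤-reflexive (sym (+-suc _ _)))
∣p∪q∣≤∣p∣+∣q∣ (inside  ∷ p) (outside ∷ q) = s≤s (∣p∪q∣≤∣p∣+∣q∣ p q)
∣p∪q∣≤∣p∣+∣q∣ (inside  ∷ p) (inside  ∷ q) =
  s≤s (≤-trans (∣p∪q∣≤∣p∣+∣q∣ p q) (+-monoʳ-≤ ∣ p ∣ (n≤1+n ∣ q ∣)))

counterexample : {P Q : Fin n → Set} → Decidable P → Decidable Q →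
  ¬ (∀ x → P x → Q x) → ∃[ x ] (P x × ¬ Q x)
counterexample {n} {P} {Q} P? Q? ¬P⊆Q
  with x , ¬imp ← Fin.¬∀⟶∃¬ n (λ x → P x → Q x) (λ x → P? x →-dec Q? x) ¬P⊆Q =
  x , decidable-stable (P? x) (λ ¬p → ¬imp λ p → contradiction p ¬p) , λ q → ¬imp λ _ → q

⊈-witness : {p q : Subset n} → p ⊈ q → ∃[ x ] (x ∈ p × x ∉ q)
⊈-witness {p = p} {q} p⊈q = counterexample (_∈? p) (_∈? q) λ p⊆q → p⊈q (p⊆q _)

⊆∧∣∣≡⇒≡ : {p q : Subset n} → p ⊆ q → ∣ p ∣ ≡ ∣ q ∣ → p ≡ q
⊆∧∣∣≡⇒≡ {p = p} {q} p⊆q eq with q ⊆? p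
... | yes q⊆p = ⊆-antisym p⊆q q⊆p
... | no  q⊈p = contradiction eq (<⇒≢ (p⊂q⇒∣p∣<∣q∣ (p⊆q , ⊈-witness q⊈p)))

∣p∣≡suc⇒Nonempty : {p : Subset n} {m : ℕ} → ∣ p ∣ ≡ suc m → Nonempty p
∣p∣≡suc⇒Nonempty {n} {p} eq with nonempty? p
... | yes ne = ne
... | no ¬ne = contradiction (trans (sym eq) (trans (cong ∣_∣ (Empty-unique ¬ne)) (∣⊥∣≡0 n))) λ ()

∈⋂⇒∈ : {x : Fin n} {ps : List (Subset n)} {p : Subset n} → x ∈ ⋂ ps → p ∈ₗ ps → x ∈ p
∈⋂⇒∈ {ps = p ∷ ps} x∈ (here refl) = proj₁ (x∈p∩q⁻ p (⋂ ps) x∈)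
∈⋂⇒∈ {ps = p ∷ ps} x∈ (there p∈)  = ∈⋂⇒∈ (proj₂ (x∈p∩q⁻ p (⋂ ps) x∈)) p∈

-- Each `q` adds at most its own point `y`; since `p` stays in the union, the other points of `q`
-- are absorbed.
∣∪⋃∣≤ : (p : Subset n) (qs : List (Subset n)) → (∀ {q} → q ∈ₗ qs → ∃[ y ] q ⊆ p ∪ ⁅ y ⁆) →
  ∣ p ∪ ⋃ qs ∣ ≤ ∣ p ∣ + length qs
∣∪⋃∣≤ {n} p [] _ = ≤-trans (∣p∪q∣≤∣p∣+∣q∣ p ⊥) (≤-reflexive (cong (∣ p ∣ +_) (∣⊥∣≡0 n)))
∣∪⋃∣≤ p (q ∷ qs) near with y , q⊆ ← near (here refl) = begin
  ∣ p ∪ (q ∪ ⋃ qs) ∣       ≤⟨ p⊆q⇒∣p∣≤∣q∣ regroup ⟩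
  ∣ ⁅ y ⁆ ∪ (p ∪ ⋃ qs) ∣   ≤⟨ ∣p∪q∣≤∣p∣+∣q∣ ⁅ y ⁆ (p ∪ ⋃ qs) ⟩
  ∣ ⁅ y ⁆ ∣ + ∣ p ∪ ⋃ qs ∣ ≡⟨ cong (_+ ∣ p ∪ ⋃ qs ∣) (∣⁅x⁆∣≡1 y) ⟩
  suc ∣ p ∪ ⋃ qs ∣         ≤⟨ s≤s (∣∪⋃∣≤ p qs (near ∘ there)) ⟩
  suc (∣ p ∣ + length qs)  ≡⟨ +-suc ∣ p ∣ (length qs) ⟨
  ∣ p ∣ + suc (length qs)  ∎
  where
  open ≤-Reasoning
  inP : ∀ {z} → z ∈ p → z ∈ ⁅ y ⁆ ∪ (p ∪ ⋃ qs)
  inP z∈ = x∈p∪q⁺ (inj₂ (x∈p∪q⁺ (inj₁ z∈)))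
  regroup : p ∪ (q ∪ ⋃ qs) ⊆ ⁅ y ⁆ ∪ (p ∪ ⋃ qs)
  regroup z∈ with x∈p∪q⁻ p (q ∪ ⋃ qs) z∈
  ... | inj₁ z∈p = inP z∈p
  ... | inj₂ z∈′ with x∈p∪q⁻ q (⋃ qs) z∈′
  ...   | inj₂ z∈U = x∈p∪q⁺ (inj₂ (x∈p∪q⁺ (inj₂ z∈U)))
  ...   | inj₁ z∈q with x∈p∪q⁻ p ⁅ y ⁆ (q⊆ z∈q)
  ...     | inj₁ z∈p = inP z∈p
  ...     | inj₂ z∈y = x∈p∪q⁺ (inj₁ z∈y)

-- Colourings from pairs of subsets

-- For `s ⊆ p` this encodes the disjoint pair (`s`, complement of `p`): the points of `p` outside
-- `s` are `free`.
sideColour : Side → Side → Colour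
sideColour inside  _       = before
sideColour outside inside  = free
sideColour outside outside = after

pairColouring : Subset n → Subset n → Colouring n
pairColouring s p i = sideColour (lookup s i) (lookup p i)

#before-pair : (s p : Subset n) → #before (pairColouring s p) ≡ ∣ s ∣
#before-pair []            []            = refl
#before-pair (inside  ∷ s) (_ ∷ p)       = cong suc (#before-pair s p)
#before-pair (outside ∷ s) (inside ∷ p)  = #before-pair s p
#before-pair (outside ∷ s) (outside ∷ p) = #before-pair s p

#after-pair : (s p : Subset n) → s ⊆ p → ∣ p ∣ + #after (pairColouring s p) ≡ n
#after-pair []            []            _   = refl
#after-pair (inside  ∷ s) (inside  ∷ p) s⊆p = cong suc (#after-pair s p (drop-∷-⊆ s⊆p))
#after-pair (inside  ∷ s) (outside ∷ p) s⊆p = case s⊆p here of λ ()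
#after-pair (outside ∷ s) (inside  ∷ p) s⊆p = cong suc (#after-pair s p (drop-∷-⊆ s⊆p))
#after-pair (outside ∷ s) (outside ∷ p) s⊆p =
  trans (+-suc ∣ p ∣ _) (cong suc (#after-pair s p (drop-∷-⊆ s⊆p)))

lookup-∉ : {p : Subset n} {x : Fin n} → x ∉ p → lookup p x ≡ outside
lookup-∉ {p = p} {x} x∉ with lookup p x in eq
... | outside = refl
... | inside  = contradiction (lookup⇒[]= x p eq) x∉

pair-before : {s : Subset n} (p : Subset n) {x : Fin n} → x ∈ s → pairColouring s p x ≡ before
pair-before p x∈ rewrite []=⇒lookup x∈ = refl

pair-after : {s p : Subset n} {x : Fin n} → s ⊆ p → x ∉ p → pairColouring s p x ≡ after
pair-after s⊆p x∉ rewrite lookup-∉ (x∉ ∘ s⊆p) | lookup-∉ x∉ = refl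

-- A point of `s` outside `p′` is `before` in the first colouring and `after` in the second; a point
-- of `s′` outside `p` does the converse.
pair-cross : {s p s′ p′ : Subset n} → s ⊆ p → s′ ⊆ p′ → s ⊈ p′ → s′ ⊈ p →
  Cross (pairColouring s p) (pairColouring s′ p′)
pair-cross {p = p} {p′ = p′} s⊆p s′⊆p′ s⊈p′ s′⊈p
  with i , i∈ , i∉ ← ⊈-witness s⊈p′ | j , j∈ , j∉ ← ⊈-witness s′⊈p =
  (i , pair-before p i∈ , pair-after s′⊆p′ i∉) , (j , pair-before p′ j∈ , pair-after s⊆p j∉)

orders-pair : {s p : Subset n} {a b : ℕ} → s ⊆ p → ∣ s ∣ ≡ a → ∣ p ∣ + b ≡ n →
  orders (pairColouring s p) * (a + b) ! ≡ n ! * (a ! * b !)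
orders-pair {s = s} {p} {b = b} s⊆p refl ∣p∣+b≡n
  with eq ← orders-formula (pairColouring s p)
  rewrite #before-pair s p
        | +-cancelˡ-≡ ∣ p ∣ (#after (pairColouring s p)) b
            (trans (#after-pair s p s⊆p) (sym ∣p∣+b≡n))
  = eq

-- The structure of a family without k-clusters

module Covering {n t : ℕ} (𝓕 : Family n (suc (suc t)))
  (ci : ConditionallyIntersecting (suc (suc t)) (2 * suc (suc t)) 𝓕) where

  F : List (Subset n)
  F = members 𝓕

  ∣∣≡k : ∀ {A} → A ∈ₗ F → ∣ A ∣ ≡ suc (suc t)
  ∣∣≡k = All.lookup (uniform 𝓕)

  Covers : Subset n → Fin n → Subset n → Set
  Covers A x B = B ≢ A × A - x ⊆ B

  Covered : Subset n → Fin n → Set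
  Covered A x = Any (Covers A x) F

  covered? : ∀ A x → Dec (Covered A x)
  covered? A x = Any.any? (λ B → ¬? (B ≟ₛ A) ×-dec (A - x ⊆? B)) F

  Full : Subset n → Set
  Full A = ∀ x → x ∈ A → Covered A x

  full? : Decidable Full
  full? A = Fin.all? (λ x → (x ∈? A) →-dec covered? A x)

  -- Among sets of equal size these fields amount to B = (A - x) ∪ ⁅ y ⁆ ≠ A.
  record Exchange (A : Subset n) (x : Fin n) (B : Subset n) (y : Fin n) : Set where
    field
      x∉B   : x ∉ B
      y∉A   : y ∉ A
      y∈B   : y ∈ B
      A-x⊆B : A - x ⊆ B
      B-y⊆A : ∀ {z} → z ∈ B → z ≢ y → z ∈ A

  open Exchange

  -- Everything follows from equal sizes. If `x ∈ B`, then `A ⊆ B` and so `A ≡ B`. As `B ⊈ A`, some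
  -- `y ∈ B` lies outside `A`; a second such point would make `A - x` a proper subset of `B - y`,
  -- which has the same size.
  exchange : ∀ {A B x} → A ∈ₗ F → B ∈ₗ F → x ∈ A → Covers A x B → ∃[ y ] Exchange A x B y
  exchange {A} {B} {x} A∈ B∈ x∈A (B≢A , A-x⊆B) = let y , y∈B , y∉A = ⊈-witness B⊈A in y , record
    { x∉B   = x∉B′
    ; y∉A   = y∉A
    ; y∈B   = y∈B
    ; A-x⊆B = A-x⊆B
    ; B-y⊆A = λ {z} z∈B z≢y → decidable-stable (z ∈? A) λ z∉A →
        <⇒≢ (p⊂q⇒∣p∣<∣q∣ (A-x⊆B-y y∉A , z , x∈p∧x≢y⇒x∈p-y z∈B z≢y , z∉A ∘ p-x⊆p A x))
          (suc-injective (trans (suc∣p-x∣≡∣p∣ x∈A) (trans ∣A∣≡∣B∣ (sym (suc∣p-x∣≡∣p∣ y∈B)))))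
    }
    where
    ∣A∣≡∣B∣ : ∣ A ∣ ≡ ∣ B ∣
    ∣A∣≡∣B∣ = trans (∣∣≡k A∈) (sym (∣∣≡k B∈))

    B⊈A : B ⊈ A
    B⊈A B⊆A = B≢A (⊆∧∣∣≡⇒≡ B⊆A (sym ∣A∣≡∣B∣))

    x∉B′ : x ∉ B
    x∉B′ x∈B = B≢A (sym (⊆∧∣∣≡⇒≡ A⊆B ∣A∣≡∣B∣))
      where
      A⊆B : A ⊆ B
      A⊆B {z} z∈A with z Fin.≟ x
      ... | yes refl = x∈B
      ... | no z≢x   = A-x⊆B (x∈p∧x≢y⇒x∈p-y z∈A z≢x)

    A-x⊆B-y : ∀ {y} → y ∉ A → A - x ⊆ B - y
    A-x⊆B-y y∉A z∈ = x∈p∧x≢y⇒x∈p-y (A-x⊆B z∈) λ { refl → y∉A (p-x⊆p A x z∈) }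

  -- A itself is a junk value.
  coverFrom : ∀ {A x} → Dec (Covered A x) → Subset n
  coverFrom     (yes c) = proj₁ (find c)
  coverFrom {A} (no _)  = A

  cover : Subset n → Fin n → Subset n
  cover A x = coverFrom (covered? A x)

  cover-covers : ∀ {A x} → Covered A x → cover A x ∈ₗ F × Covers A x (cover A x)
  cover-covers {A} {x} c = from (covered? A x)
    where
    from : (d : Dec (Covered A x)) → coverFrom d ∈ₗ F × Covers A x (coverFrom d)
    from (yes c) = proj₂ (find c)
    from (no ¬c) = contradiction c ¬c

  -- The `k` sets `g x` are distinct, since `g x` misses `x` while every other `g y` contains it.
  -- Each adds at most one point to `A`, so their union has at most `2k` points. No `x ∈ A` is
  -- common to all because `g x` misses it, and the last hypothesis would exclude the points outside
  -- `A`.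
  no-cluster : ∀ {A} (g : Fin n → Subset n) → A ∈ₗ F →
    (∀ {x} → x ∈ A → g x ∈ₗ F × Covers A x (g x)) →
    ¬ (∀ {w} → w ∉ A → ∃[ x ] (x ∈ A × w ∉ g x))
  no-cluster {A} g A∈ covers escape =
    ci (map g (elements A) , length≡k , unique , members⊆ , ∣⋃∣≤2k , empty)
    where
    length≡k : length (map g (elements A)) ≡ suc (suc t)
    length≡k = trans (length-map g (elements A)) (trans (length-elements A) (∣∣≡k A∈))

    x∉gx : ∀ {x} → x ∈ A → x ∉ g x
    x∉gx x∈A with gx∈ , c ← covers x∈A = x∉B (proj₂ (exchange A∈ gx∈ x∈A c))

    unique : Unique (map g (elements A))
    unique = allPairs-map⁺ (λ x∈ y∈ x≢y gx≡gy → x∉gx (∈-elements⁻ A x∈)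
      (subst (_ ∈_) (sym gx≡gy)
        (proj₂ (proj₂ (covers (∈-elements⁻ A y∈))) (x∈p∧x≢y⇒x∈p-y (∈-elements⁻ A x∈) x≢y))))
      (elements-unique A)

    members⊆ : map g (elements A) List.⊆ F
    members⊆ B∈ with x , x∈ , refl ← ∈-map⁻ g B∈ = proj₁ (covers (∈-elements⁻ A x∈))

    near : ∀ {B} → B ∈ₗ map g (elements A) → ∃[ y ] B ⊆ A ∪ ⁅ y ⁆
    near B∈ with x , x∈ , refl ← ∈-map⁻ g B∈
               with gx∈ , c ← covers (∈-elements⁻ A x∈)
               with y , ex ← exchange A∈ gx∈ (∈-elements⁻ A x∈) c = y , λ {z} → within y ex {z}
      where
      within : ∀ {x} y → Exchange A x (g x) y → g x ⊆ A ∪ ⁅ y ⁆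
      within y ex {z} z∈ with z Fin.≟ y
      ... | yes refl = x∈p∪q⁺ (inj₂ (x∈⁅x⁆ y))
      ... | no z≢y   = x∈p∪q⁺ (inj₁ (B-y⊆A ex z∈ z≢y))

    ∣⋃∣≤2k : ∣ ⋃ (map g (elements A)) ∣ ≤ 2 * suc (suc t)
    ∣⋃∣≤2k = begin
      ∣ ⋃ (map g (elements A)) ∣              ≤⟨ p⊆q⇒∣p∣≤∣q∣ (λ z∈ → x∈p∪q⁺ {p = A} (inj₂ z∈)) ⟩
      ∣ A ∪ ⋃ (map g (elements A)) ∣          ≤⟨ ∣∪⋃∣≤ A (map g (elements A)) near ⟩
      ∣ A ∣ + length (map g (elements A))     ≡⟨ cong₂ _+_ (∣∣≡k A∈) length≡k ⟩
      suc (suc t) + suc (suc t)               ≡⟨ cong (suc (suc t) +_) (+-identityʳ (suc (suc t))) ⟨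
      2 * suc (suc t) ∎
      where open ≤-Reasoning

    empty : Empty (⋂ (map g (elements A)))
    empty (w , w∈⋂) with w ∈? A
    ... | yes w∈A = x∉gx w∈A (∈⋂⇒∈ w∈⋂ (∈-map⁺ g (∈-elements⁺ w∈A)))
    ... | no w∉A with x , x∈A , w∉gx ← escape w∉A = w∉gx (∈⋂⇒∈ w∈⋂ (∈-map⁺ g (∈-elements⁺ x∈A)))

  -- Exchanges around a member all of whose facets are covered.

  module _ {A : Subset n} (A∈ : A ∈ₗ F) (full : Full A) where

    another : ∀ {x} → x ∈ A → ∃[ z ] (z ∈ A × z ≢ x)
    another {x} x∈A
      with z , z∈ ← ∣p∣≡suc⇒Nonempty (suc-injective (trans (suc∣p-x∣≡∣p∣ x∈A) (∣∣≡k A∈))) =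
      z , p-x⊆p A x z∈ , x∈p-y⇒x≢y z∈

    exchange-at : ∀ {x} → x ∈ A → cover A x ∈ₗ F × ∃[ y ] Exchange A x (cover A x) y
    exchange-at x∈A with c∈ , c ← cover-covers (full _ x∈A) = c∈ , exchange A∈ c∈ x∈A c

    exchange⇒covers : ∀ {x B y} → Exchange A x B y → Covers A x B
    exchange⇒covers e = (λ { refl → y∉A e (y∈B e) }) , λ {z} → A-x⊆B e {z}

    -- Otherwise choose `B` at `x`, `B′` at `x′` and `cover A z` at every other `z`. Outside `A`,
    -- the set `B` has only `y` and `B′` only `y′`, so no point there is common to both,
    -- contradicting `no-cluster`.
    same-new-point-≢ : ∀ {x B y x′ B′ y′} → x ∈ A → x′ ∈ A → B ∈ₗ F → B′ ∈ₗ F →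
      Exchange A x B y → Exchange A x′ B′ y′ → x ≢ x′ → y ≡ y′
    same-new-point-≢ {x} {B} {y} {x′} {B′} {y′} x∈A x′∈A B∈ B′∈ e e′ x≢x′ =
      decidable-stable (y Fin.≟ y′) λ y≢y′ → no-cluster g A∈ covers (escape y≢y′)
      where
      g : Fin n → Subset n
      g z = if does (z Fin.≟ x) then B else if does (z Fin.≟ x′) then B′ else cover A z

      gx≡B : g x ≡ B
      gx≡B rewrite dec-true (x Fin.≟ x) refl = refl

      gx′≡B′ : g x′ ≡ B′
      gx′≡B′ rewrite dec-false (x′ Fin.≟ x) (x≢x′ ∘ sym) | dec-true (x′ Fin.≟ x′) refl = refl

      covers : ∀ {z} → z ∈ A → g z ∈ₗ F × Covers A z (g z)
      covers {z} z∈A with z Fin.≟ x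
      ... | yes refl = B∈ , exchange⇒covers e
      ... | no _ with z Fin.≟ x′
      ...   | yes refl = B′∈ , exchange⇒covers e′
      ...   | no _     = cover-covers (full z z∈A)

      escape : y ≢ y′ → ∀ {w} → w ∉ A → ∃[ z ] (z ∈ A × w ∉ g z)
      escape y≢y′ {w} w∉A with w Fin.≟ y
      ... | no w≢y   = x , x∈A , λ w∈ → w∉A (B-y⊆A e (subst (w ∈_) gx≡B w∈) w≢y)
      ... | yes refl = x′ , x′∈A , λ w∈ → w∉A (B-y⊆A e′ (subst (w ∈_) gx′≡B′ w∈) y≢y′)

    same-new-point : ∀ {x B y x′ B′ y′} → x ∈ A → x′ ∈ A → B ∈ₗ F → B′ ∈ₗ F →
      Exchange A x B y → Exchange A x′ B′ y′ → y ≡ y′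
    same-new-point {x} {x′ = x′} x∈A x′∈A B∈ B′∈ e e′ with x Fin.≟ x′
    ... | no x≢x′  = same-new-point-≢ x∈A x′∈A B∈ B′∈ e e′ x≢x′
    -- Two exchanges at the same `x` are compared through an exchange at a different point `z`.
    ... | yes refl with z , z∈A , z≢x ← another x∈A
                   with E∈ , _ , d ← exchange-at z∈A =
      trans (same-new-point-≢ x∈A z∈A B∈ E∈ e d (z≢x ∘ sym))
            (same-new-point-≢ z∈A x∈A E∈ B′∈ d e′ z≢x)

    -- The facet `B - y` is `A - x`, which lies in `A`. For any other `z ∈ B`, the cover `E` of `A`
    -- at `z` has the same new point `y`, so it contains `B - z`; it differs from `B` because it
    -- contains `x`.
    full-exchange : ∀ {x B y} → x ∈ A → B ∈ₗ F → Exchange A x B y → Full B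
    full-exchange {x} {B} {y} x∈A B∈ e z z∈B with z Fin.≟ y
    ... | yes refl = lose A∈
      ((λ { refl → x∉B e x∈A }) , λ w∈ → B-y⊆A e (p-x⊆p B z w∈) (x∈p-y⇒x≢y w∈))
    ... | no z≢y with z∈A ← B-y⊆A e z∈B z≢y
                 with E∈ , _ , d ← exchange-at z∈A
                 with refl ← same-new-point x∈A z∈A B∈ E∈ e d =
      lose E∈ (E≢B d , λ {w} → B-z⊆E d {w})
      where
      x≢z : x ≢ z
      x≢z refl = x∉B e z∈B
      E≢B : ∀ {E} → Exchange A z E y → E ≢ B
      E≢B d refl = x∉B e (A-x⊆B d (x∈p∧x≢y⇒x∈p-y x∈A x≢z))
      B-z⊆E : ∀ {E} → Exchange A z E y → B - z ⊆ E
      B-z⊆E d {w} w∈ with w Fin.≟ y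
      ... | yes refl = y∈B d
      ... | no w≢y   = A-x⊆B d (x∈p∧x≢y⇒x∈p-y (B-y⊆A e (p-x⊆p B z w∈) w≢y) (x∈p-y⇒x≢y w∈))

    -- Consequently a member that is not full contains no set of `∂F₂`, as the crossing in `cross₁₂`
    -- requires.
    full-facet : ∀ {x E} → x ∈ A → E ∈ₗ F → A - x ⊆ E → Full E
    full-facet {x} {E} x∈A E∈ A-x⊆E with E ≟ₛ A
    ... | yes refl = full
    ... | no E≢A   = full-exchange x∈A E∈ (proj₂ (exchange A∈ E∈ x∈A (E≢A , λ {z} → A-x⊆E {z})))

    -- A member `E ≢ A` above `A - x` has the same new point as `cover A x`, so both are `A - x`
    -- with that point added.
    facet-in-two : ∀ {x E} → x ∈ A → E ∈ₗ F → A - x ⊆ E → E ∈ₗ A ∷ cover A x ∷ []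
    facet-in-two {x} {E} x∈A E∈ A-x⊆E with E ≟ₛ A
    ... | yes refl = here refl
    ... | no E≢A   with B∈ , y , e ← exchange-at x∈A
                   with y′ , d ← exchange A∈ E∈ x∈A (E≢A , λ {z} → A-x⊆E {z})
                   with refl ← same-new-point x∈A x∈A B∈ E∈ e d =
      there (here (⊆∧∣∣≡⇒≡ E⊆B (trans (∣∣≡k E∈) (sym (∣∣≡k B∈)))))
      where
      E⊆B : E ⊆ cover A x
      E⊆B {z} z∈E with z Fin.≟ y
      ... | yes refl = y∈B e
      ... | no z≢y   = A-x⊆B e (x∈p∧x≢y⇒x∈p-y (B-y⊆A d z∈E z≢y) λ { refl → x∉B d z∈E })

-- Counting

binomial-factorials : ∀ a b → ((a + b) C a) * (a ! * b !) ≡ (a + b) !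
binomial-factorials a b = begin
  ((a + b) C a) * (a ! * b !)
    ≡⟨ cong (λ m → ((a + b) C a) * (a ! * m !)) (m+n∸m≡n a b) ⟨
  ((a + b) C a) * (a ! * (a + b ∸ a) !)
    ≡⟨ cong (_* (a ! * (a + b ∸ a) !)) (nCk≡n!/k![n-k]! (m≤m+n a b)) ⟩
  _
    ≡⟨ m/n*n≡m (k![n∸k]!∣n! (m≤m+n a b)) ⟩
  (a + b) ! ∎
  where
  open ≡-Reasoning
  instance _ = a !* (a + b ∸ a) !≢0

module Counting {n t b : ℕ} (𝓕 : Family n (suc (suc t)))
  (ci : ConditionallyIntersecting (suc (suc t)) (2 * suc (suc t)) 𝓕)
  (k+b≡n : suc (suc t) + b ≡ n) where

  open Covering 𝓕 ci

  F₁ F₂ ∂F₂ : List (Subset n)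
  F₁  = filter (¬? ∘ full?) F
  F₂  = filter full? F
  ∂F₂ = deduplicate _≟ₛ_ (concatMap facets F₂)
    where
    facets : Subset n → List (Subset n)
    facets A = map (A -_) (elements A)

  ∈-∂F₂⁻ : ∀ {S} → S ∈ₗ ∂F₂ → ∃[ A ] ∃[ x ] (A ∈ₗ F × Full A × x ∈ A × S ≡ A - x)
  ∈-∂F₂⁻ S∈ with A , A∈F₂ , S∈′ ← find (∈-concatMap⁻ _ {xs = F₂} (∈-deduplicate⁻ _≟ₛ_ _ S∈))
            with x , x∈ , S≡ ← ∈-map⁻ (A -_) S∈′
            with A∈ , full ← ∈-filter⁻ full? {xs = F} A∈F₂ =
    A , x , A∈ , full , ∈-elements⁻ A x∈ , S≡

  ∈-∂F₂⁺ : ∀ {A x} → A ∈ₗ F₂ → x ∈ A → A - x ∈ₗ ∂F₂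
  ∈-∂F₂⁺ {A} A∈F₂ x∈A =
    ∈-deduplicate⁺ _≟ₛ_ (∈-concatMap⁺ _ {xs = F₂} (lose A∈F₂ (∈-map⁺ (A -_) (∈-elements⁺ x∈A))))

  ∣facet∣ : ∀ {A x} → A ∈ₗ F → x ∈ A → ∣ A - x ∣ ≡ suc t
  ∣facet∣ A∈ x∈A = suc-injective (trans (suc∣p-x∣≡∣p∣ x∈A) (∣∣≡k A∈))

  ∣∂F₂∣ : ∀ {S} → S ∈ₗ ∂F₂ → ∣ S ∣ ≡ suc t
  ∣∂F₂∣ S∈ with A , x , A∈ , _ , x∈A , refl ← ∈-∂F₂⁻ S∈ = ∣facet∣ A∈ x∈A

  contains? : B.Decidable {A = Subset n} {B = Subset n} (λ A S → S ⊆ A)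
  contains? A S = S ⊆? A

  k≤facets : ∀ {A} → A ∈ₗ F₂ → suc (suc t) ≤ outDegree contains? ∂F₂ A
  k≤facets {A} A∈F₂ = begin
    suc (suc t)                    ≡⟨ ∣∣≡k (proj₁ (∈-filter⁻ full? {xs = F} A∈F₂)) ⟨
    ∣ A ∣                          ≡⟨ length-elements A ⟨
    length (elements A)            ≡⟨ length-map (A -_) (elements A) ⟨
    length (map (A -_) (elements A)) ≤⟨ unique-⊆⇒length≤ facets-unique facets⊆ ⟩
    outDegree contains? ∂F₂ A      ∎
    where
    open ≤-Reasoning
    facets-unique : Unique (map (A -_) (elements A))
    facets-unique = allPairs-map⁺
      (λ {x} {y} x∈ y∈ x≢y eq →
        x∉p-x A x (subst (x ∈_) (sym eq) (x∈p∧x≢y⇒x∈p-y (∈-elements⁻ A x∈) x≢y)))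
      (elements-unique A)
    facets⊆ : map (A -_) (elements A) List.⊆ filter (contains? A) ∂F₂
    facets⊆ S∈ with x , x∈ , refl ← ∈-map⁻ (A -_) S∈ =
      ∈-filter⁺ (contains? A) (∈-∂F₂⁺ A∈F₂ (∈-elements⁻ A x∈)) (p-x⊆p A x)

  -- By `facet-in-two`, all these members occur in the two-element list `A ∷ cover A x ∷ []`.
  members-above≤2 : ∀ {S} → S ∈ₗ ∂F₂ → inDegree contains? F₂ S ≤ 2
  members-above≤2 {S} S∈ with A , x , A∈ , full , x∈A , refl ← ∈-∂F₂⁻ S∈ =
    unique-⊆⇒length≤
      (Unique.filter⁺ (λ B → contains? B S) (Unique.filter⁺ full? (distinct 𝓕))) λ B∈ →
      let B∈F₂ , S⊆B = ∈-filter⁻ (λ B → contains? B S) {xs = F₂} B∈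
      in facet-in-two A∈ full x∈A (proj₁ (∈-filter⁻ full? {xs = F} B∈F₂)) S⊆B

  -- The containments between `∂F₂` and `F₂` are counted in two ways.
  k∣F₂∣≤2∣∂F₂∣ : length F₂ * suc (suc t) ≤ length ∂F₂ * 2
  k∣F₂∣≤2∣∂F₂∣ = begin
    length F₂ * suc (suc t)
      ≡⟨ sum-map-const (λ _ → suc (suc t)) (suc (suc t)) F₂ (λ _ → refl) ⟨
    ListAction.sum (map (λ _ → suc (suc t)) F₂)
      ≤⟨ sum-map-mono _ _ F₂ k≤facets ⟩
    ListAction.sum (map (outDegree contains? ∂F₂) F₂)
      ≡⟨ double-counting contains? F₂ ∂F₂ ⟩
    ListAction.sum (map (inDegree contains? F₂) ∂F₂)
      ≤⟨ sum-map-mono _ _ ∂F₂ members-above≤2 ⟩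
    ListAction.sum (map (λ _ → 2) ∂F₂)
      ≡⟨ sum-map-const (λ _ → 2) 2 ∂F₂ (λ _ → refl) ⟩
    length ∂F₂ * 2 ∎
    where open ≤-Reasoning

  -- Own facets, crossing pairs and the weighted inequality.

  uncovered : ∀ {A} → ¬ Full A → ∃[ x ] (x ∈ A × ¬ Covered A x)
  uncovered {A} = counterexample (_∈? A) (covered? A)

  -- A itself is a junk value.
  ownFacetFrom : ∀ {A} → Dec (Full A) → Subset n
  ownFacetFrom {A} (yes _)    = A
  ownFacetFrom {A} (no ¬full) = A - proj₁ (uncovered ¬full)

  ownFacet : Subset n → Subset n
  ownFacet A = ownFacetFrom (full? A)

  ownFacet-facet : ∀ {A} → ¬ Full A → ∃[ x ] (x ∈ A × ¬ Covered A x × ownFacet A ≡ A - x)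
  ownFacet-facet {A} ¬full = from (full? A)
    where
    from : (d : Dec (Full A)) → ∃[ x ] (x ∈ A × ¬ Covered A x × ownFacetFrom d ≡ A - x)
    from (yes full)  = contradiction full ¬full
    from (no ¬full′) = let x , x∈A , ¬c = uncovered ¬full′ in x , x∈A , ¬c , refl

  F₁⁻ : ∀ {A} → A ∈ₗ F₁ → A ∈ₗ F × ¬ Full A
  F₁⁻ = ∈-filter⁻ (¬? ∘ full?) {xs = F}

  ownFacet⊆ : ∀ {A} → A ∈ₗ F₁ → ownFacet A ⊆ A
  ownFacet⊆ {A} A∈F₁ z∈ with x , _ , _ , eq ← ownFacet-facet (proj₂ (F₁⁻ A∈F₁)) =
    p-x⊆p A x (subst (_ ∈_) eq z∈)

  ownFacet⊈ : ∀ {A B} → A ∈ₗ F₁ → B ∈ₗ F → B ≢ A → ownFacet A ⊈ B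
  ownFacet⊈ {A} A∈F₁ B∈ B≢A sub with x , _ , ¬c , eq ← ownFacet-facet (proj₂ (F₁⁻ A∈F₁)) =
    ¬c (lose B∈ (B≢A , λ {z} z∈ → sub (subst (z ∈_) (sym eq) z∈)))

  ∣ownFacet∣ : ∀ {A} → A ∈ₗ F₁ → ∣ ownFacet A ∣ ≡ suc t
  ∣ownFacet∣ A∈F₁ with A∈ , ¬full ← F₁⁻ A∈F₁ with x , x∈A , _ , eq ← ownFacet-facet ¬full =
    trans (cong ∣_∣ eq) (∣facet∣ A∈ x∈A)

  colouring₁ colouring₂ : Subset n → Colouring n
  colouring₁ A = pairColouring (ownFacet A) A
  colouring₂ S = pairColouring S S

  cross₁ : AllPairs Cross (map colouring₁ F₁)
  cross₁ = allPairs-map⁺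
    (λ A∈ B∈ A≢B → pair-cross (ownFacet⊆ A∈) (ownFacet⊆ B∈)
      (ownFacet⊈ A∈ (proj₁ (F₁⁻ B∈)) (A≢B ∘ sym)) (ownFacet⊈ B∈ (proj₁ (F₁⁻ A∈)) A≢B))
    (Unique.filter⁺ (¬? ∘ full?) (distinct 𝓕))

  -- Distinct sets of equal size do not contain one another.
  cross₂ : AllPairs Cross (map colouring₂ ∂F₂)
  cross₂ = allPairs-map⁺
    (λ S∈ T∈ S≢T →
      let ∣S∣≡∣T∣ = trans (∣∂F₂∣ S∈) (sym (∣∂F₂∣ T∈))
      in pair-cross (λ z∈ → z∈) (λ z∈ → z∈)
           (λ S⊆T → S≢T (⊆∧∣∣≡⇒≡ S⊆T ∣S∣≡∣T∣))
           (λ T⊆S → S≢T (sym (⊆∧∣∣≡⇒≡ T⊆S (sym ∣S∣≡∣T∣)))))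
    (deduplicate-! _≟ₛ_ _)

  -- If `ownFacet A ⊆ S`, it would lie in the full member `B` above `S`, which differs from `A`. If
  -- `S ⊆ A`, then `full-facet` would make `A` full.
  cross₁₂ : ∀ {A S} → A ∈ₗ F₁ → S ∈ₗ ∂F₂ → Cross (colouring₁ A) (colouring₂ S)
  cross₁₂ {A} A∈F₁ S∈ with B , x , B∈ , full , x∈B , refl ← ∈-∂F₂⁻ S∈ with A∈ , ¬full ← F₁⁻ A∈F₁ =
    pair-cross (ownFacet⊆ A∈F₁) (λ z∈ → z∈)
      (λ sub → ownFacet⊈ A∈F₁ B∈ (λ { refl → ¬full full }) λ z∈ → p-x⊆p B x (sub z∈))
      (λ sub → ¬full (full-facet B∈ full x∈B A∈ sub))

  -- There are `k - 1` points `before`, `b = n - k` points `after` and one `free` point, so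
  -- `orders-formula` is divided by `(n - 1)!`.
  orders₁ : ∀ {A} → A ∈ₗ F₁ → orders (colouring₁ A) ≡ n * (suc t ! * b !)
  orders₁ {A} A∈F₁ = *-cancelʳ-≡ _ _ ((suc t + b) !) {{(suc t + b) !≢0}} (begin
    orders (colouring₁ A) * (suc t + b) !
      ≡⟨ orders-pair (ownFacet⊆ A∈F₁) (∣ownFacet∣ A∈F₁)
           (trans (cong (_+ b) (∣∣≡k (proj₁ (F₁⁻ A∈F₁)))) k+b≡n) ⟩
    n ! * (suc t ! * b !)
      ≡⟨ cong (λ m → m ! * (suc t ! * b !)) k+b≡n ⟨
    suc (suc t + b) * (suc t + b) ! * (suc t ! * b !)
      ≡⟨ swap (suc (suc t + b)) ((suc t + b) !) (suc t ! * b !) ⟩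
    suc (suc t + b) * (suc t ! * b !) * (suc t + b) !
      ≡⟨ cong (λ m → m * (suc t ! * b !) * (suc t + b) !) k+b≡n ⟩
    n * (suc t ! * b !) * (suc t + b) ! ∎)
    where
    open ≡-Reasoning
    swap : ∀ x y z → x * y * z ≡ x * z * y
    swap = solve-∀

  -- No point is `free` here: `k - 1` points are `before` and `suc b` are `after`.
  orders₂ : ∀ {S} → S ∈ₗ ∂F₂ → orders (colouring₂ S) ≡ suc b * (suc t ! * b !)
  orders₂ {S} S∈ = *-cancelʳ-≡ _ _ (n !) {{n !≢0}} (begin
    orders (colouring₂ S) * n !
      ≡⟨ cong (λ m → orders (colouring₂ S) * m !) t+b≡n ⟨
    orders (colouring₂ S) * (suc t + suc b) !
      ≡⟨ orders-pair {s = S} {p = S} (λ z∈ → z∈) (∣∂F₂∣ S∈)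
           (trans (cong (_+ suc b) (∣∂F₂∣ S∈)) t+b≡n) ⟩
    n ! * (suc t ! * suc b !)
      ≡⟨ rearrange (n !) (suc t !) (suc b) (b !) ⟩
    suc b * (suc t ! * b !) * n ! ∎)
    where
    open ≡-Reasoning
    t+b≡n : suc t + suc b ≡ n
    t+b≡n = trans (+-suc (suc t) b) k+b≡n
    rearrange : ∀ w x y z → w * (x * (y * z)) ≡ y * (x * z) * w
    rearrange = solve-∀

  -- Apply `total≤n!` to both kinds of colourings together and cancel the factor `(k - 1)! (n - k)!`
  -- common to their order counts.
  lym : length F₁ * n + length ∂F₂ * suc b ≤ n * ((suc t + b) C suc t)
  lym = *-cancelʳ-≤ _ _ (suc t ! * b !) {{suc t !* b !≢0}} (begin
    (length F₁ * n + length ∂F₂ * suc b) * P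
      ≡⟨ distribute (length F₁) n (length ∂F₂) (suc b) P ⟩
    length F₁ * (n * P) + length ∂F₂ * (suc b * P)
      ≡⟨ cong₂ _+_ (total-const colouring₁ F₁ orders₁) (total-const colouring₂ ∂F₂ orders₂) ⟨
    total (map colouring₁ F₁) + total (map colouring₂ ∂F₂)
      ≡⟨ sum-++ (map orders (map colouring₁ F₁)) (map orders (map colouring₂ ∂F₂)) ⟨
    ListAction.sum (map orders (map colouring₁ F₁) ++ map orders (map colouring₂ ∂F₂))
      ≡⟨ cong ListAction.sum (map-++ orders (map colouring₁ F₁) (map colouring₂ ∂F₂)) ⟨
    total (map colouring₁ F₁ ++ map colouring₂ ∂F₂)
      ≤⟨ total≤n! (map colouring₁ F₁ ++ map colouring₂ ∂F₂) (AllPairs.++⁺ cross₁ cross₂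
           (All.map⁺ (All.tabulate λ A∈ → All.map⁺ (All.tabulate λ S∈ → cross₁₂ A∈ S∈)))) ⟩
    n !
      ≡⟨ cong _! k+b≡n ⟨
    suc (suc t + b) * (suc t + b) !
      ≡⟨ cong₂ _*_ k+b≡n (sym (binomial-factorials (suc t) b)) ⟩
    n * (((suc t + b) C suc t) * P)
      ≡⟨ *-assoc n ((suc t + b) C suc t) P ⟨
    n * ((suc t + b) C suc t) * P ∎)
    where
    open ≤-Reasoning
    P : ℕ
    P = suc t ! * b !
    distribute : ∀ x y z w p → (x * y + z * w) * p ≡ x * (y * p) + z * (w * p)
    distribute = solve-∀
    total-const : ∀ {c} (f : Subset n → Colouring n) (Ss : List (Subset n)) →
      (∀ {S} → S ∈ₗ Ss → orders (f S) ≡ c) → total (map f Ss) ≡ length Ss * c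
    total-const f Ss eq =
      trans (cong ListAction.sum (sym (map-∘ {g = orders} {f = f} Ss)))
            (sum-map-const (orders ∘ f) _ Ss eq)

-- Numerical estimates.

-- Here k = 3 + t and n = k + 2 + b.
2n≤[n-k+1]k : ∀ t b → 1 ≤ t + b → 2 * (3 + t + (2 + b)) ≤ (3 + b) * (3 + t)
2n≤[n-k+1]k zero    (suc b) _ = ≤-trans (m≤m+n _ b) (≤-reflexive (eq b))
  where
  eq : ∀ b → 2 * (3 + (2 + suc b)) + b ≡ (3 + suc b) * 3
  eq = solve-∀
2n≤[n-k+1]k (suc t) b       _ = ≤-trans (m≤m+n _ (t + 2 * b + b * t)) (≤-reflexive (eq t b))
  where
  eq : ∀ t b → 2 * (3 + suc t + (2 + b)) + (t + 2 * b + b * t) ≡ (3 + b) * (3 + suc t)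
  eq = solve-∀

-- Doubling the first inequality and multiplying the second by `c` eliminates `D`; in use, `c` is
-- `n - k + 1`.
combine : ∀ k n c N₁ N₂ D m → N₁ * n + D * c ≤ m → N₂ * k ≤ D * 2 →
  N₁ * (2 * n) + N₂ * (c * k) ≤ 2 * m
combine k n c N₁ N₂ D m lym shadow = begin
  N₁ * (2 * n) + N₂ * (c * k)   ≡⟨ cong (N₁ * (2 * n) +_) (regroup N₂ c k) ⟩
  N₁ * (2 * n) + c * (N₂ * k)   ≤⟨ +-monoʳ-≤ (N₁ * (2 * n)) (*-monoʳ-≤ c shadow) ⟩
  N₁ * (2 * n) + c * (D * 2)    ≡⟨ factor N₁ n c D ⟩
  2 * (N₁ * n + D * c)          ≤⟨ *-monoʳ-≤ 2 lym ⟩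
  2 * m ∎
  where
  open ≤-Reasoning
  regroup : ∀ x y z → x * (y * z) ≡ y * (x * z)
  regroup = solve-∀
  factor : ∀ x y z w → x * (2 * y) + z * (w * 2) ≡ 2 * (x * y + w * z)
  factor = solve-∀

-- As `2n ≤ (n - k + 1) k`, both coefficients in `combine` are at least `2n`, which then cancels.
size-bound-averaging : ∀ t b N₁ N₂ D {c} → 1 ≤ t + b → let n = 3 + t + (2 + b) in
  N₁ * n + D * (3 + b) ≤ n * c → N₂ * (3 + t) ≤ D * 2 → N₁ + N₂ ≤ c
size-bound-averaging t b N₁ N₂ D {c} 1≤t+b lym shadow = *-cancelʳ-≤ (N₁ + N₂) c (2 * m) (begin
  (N₁ + N₂) * (2 * m)
    ≡⟨ *-distribʳ-+ (2 * m) N₁ N₂ ⟩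
  N₁ * (2 * m) + N₂ * (2 * m)
    ≤⟨ +-monoʳ-≤ (N₁ * (2 * m)) (*-monoʳ-≤ N₂ (2n≤[n-k+1]k t b 1≤t+b)) ⟩
  N₁ * (2 * m) + N₂ * ((3 + b) * (3 + t))
    ≤⟨ combine (3 + t) m (3 + b) N₁ N₂ D (m * c) lym shadow ⟩
  2 * (m * c)
    ≡⟨ *-assoc 2 m c ⟨
  2 * m * c
    ≡⟨ *-comm (2 * m) c ⟩
  c * (2 * m) ∎)
  where
  open ≤-Reasoning
  m : ℕ
  m = 3 + t + (2 + b)

-- For k = 3 and n = 5 the averaging is slightly lossy (2n > (n - k + 1) k), but
-- 9 (N₁ + N₂) ≤ 60 still forces N₁ + N₂ ≤ 6.
size-bound : ∀ t b N₁ N₂ D → let n = 3 + t + (2 + b); c = (2 + t + (2 + b)) C (2 + t) in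
  N₁ * n + D * (3 + b) ≤ n * c → N₂ * (3 + t) ≤ D * 2 → N₁ + N₂ ≤ c
size-bound zero zero N₁ N₂ D lym shadow = ≤-pred (*-cancelʳ-< 9 (N₁ + N₂) 7 (begin-strict
  (N₁ + N₂) * 9    ≡⟨ *-distribʳ-+ 9 N₁ N₂ ⟩
  N₁ * 9 + N₂ * 9  ≤⟨ +-monoˡ-≤ (N₂ * 9) (*-monoʳ-≤ N₁ (n≤1+n 9)) ⟩
  -- Here `10 = 2n`, `9 = (n - k + 1) k` and `30 = n (4 C 2)`.
  N₁ * 10 + N₂ * 9 ≤⟨ combine 3 5 3 N₁ N₂ D 30 lym shadow ⟩
  60               <⟨ m<m+n 60 {3} (s≤s z≤n) ⟩
  63 ∎))
  where open ≤-Reasoning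
size-bound zero    (suc b) N₁ N₂ D = size-bound-averaging zero (suc b) N₁ N₂ D (s≤s z≤n)
size-bound (suc t) b       N₁ N₂ D = size-bound-averaging (suc t) b N₁ N₂ D (s≤s z≤n)

-- With `m = k - 1`, the bound `n ≤ k + 1` would give `n m ≤ (k + 1)(k - 1) = k² - 1`.
k+2≤n : ∀ m n → n * m ≥ suc m * suc m → 3 + m ≤ n
k+2≤n m n h = ≰⇒> λ n≤2+m → <⇒≱ (begin-strict
  n * m             ≤⟨ *-monoˡ-≤ m n≤2+m ⟩
  (2 + m) * m       <⟨ ≤-reflexive (square m) ⟩
  suc m * suc m     ∎) h
  where
  open ≤-Reasoning
  square : ∀ m → suc ((2 + m) * m) ≡ suc m * suc m
  square = solve-∀

shift : ∀ t b → 3 + t + (2 + b) ≡ 5 + t + b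
shift = solve-∀

theorem1p9 : (k n : ℕ) → k ≥ 3 → n * (k ∸ 1) ≥ k * k →
    (F : Family n k) → ConditionallyIntersecting k (2 * k) F →
    size F ≤ (n ∸ 1) C (k ∸ 1)
theorem1p9 (suc (suc (suc t))) n (s≤s (s≤s (s≤s z≤n))) n[k-1]≥k² F ci
  with b , 5+t+b≡n ← m≤n⇒∃[o]m+o≡n (k+2≤n (2 + t) n n[k-1]≥k²)
  -- Writing `n` as `k + (2 + b)` lets `refl` instantiate `Counting` with `n - k = 2 + b`.
  with refl ← trans (shift t b) 5+t+b≡n = begin
  size F
    ≡⟨ length-filter-¬ full? (members F) ⟨
  length F₁ + length F₂
    ≤⟨ size-bound t b (length F₁) (length F₂) (length ∂F₂) lym k∣F₂∣≤2∣∂F₂∣ ⟩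
  (n ∸ 1) C (2 + t) ∎
  where
  open ≤-Reasoning
  open Covering F ci using (full?)
  open Counting F ci refl
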